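{- Let $\varphi$ be a GFG-QPTL formula, $\mathcal X\in\mathrm{HAsg}_\supseteq(\mathrm{free}(\varphi))$ and $\alpha$ an alternation flag. Then $\overline{\mathcal X}\models^{\bar\alpha}\varphi$ iff $\overline{\overline{\mathcal X}}\models^\alpha\varphi$ iff $\mathcal X\models^\alpha\varphi$.
   Context: Let $AP$ be a set of atomic propositions and $\mathbb B=\{\top,\bot\}$. A temporal valuation is a function $f:\mathbb N\to\mathbb B$. An assignment is a partial function $\chi:AP\rightharpoonup(\mathbb N\to\mathbb B)$; $\mathrm{Asg}$ is the set of all assignments, $\mathrm{Asg}(P)$ the set of assignments with domain exactly $P\subseteq AP$. For an assignment $\chi$, $p\in AP$ and a temporal valuation $f$, $\chi[p\mapsto f]$ is the assignment that agrees with $\chi$ except that it maps $p$ to $f$. A hyperassignment is a set $\mathcal X$ with $\emptyset\neq\mathcal X\subseteq 2^{\mathrm{Asg}(P)}$ and $\emptyset\notin\mathcal X$, for some $P\subseteq AP$; this $P$ is denoted $\mathrm{ap}(\mathcal X)$. $\mathrm{HAsg}$ is the set of all hyperassignments, $\mathrm{HAsg}(P)$ those with $\mathrm{ap}(\mathcal X)=P$, and $\mathrm{HAsg}_\supseteq(P)$ those with $\mathrm{ap}(\mathcal X)\supseteq P$. A choice function for $\mathcal X$ is a map $c:\mathcal X\to\mathrm{Asg}$ with $c(X)\in X$ for all $X\in\mathcal X$. The dual of $\mathcal X$ is $\overline{\mathcal X}=\{\mathrm{img}(c): c\text{ a choice function for }\mathcal X\}$. $\mathrm{par}(\mathcal X)$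 is the set of pairs $(\mathcal X_1,\mathcal X_2)$ of (possibly empty) subsets of $\mathcal X$ with $\mathcal X_1\cap\mathcal X_2=\emptyset$ and $\mathcal X_1\cup\mathcal X_2=\mathcal X$. A functor over $P\subseteq AP$ is a function $F:\mathrm{Asg}(P)\to(\mathbb N\to\mathbb B)$; $\mathrm{Fnc}(P)$ is the set of all of them. $\mathrm{ext}(\chi,F,p)=\chi[p\mapsto F(\chi)]$ and $\mathrm{ext}(X,F,p)=\{\mathrm{ext}(\chi,F,p):\chi\in X\}$. For $\chi_1,\chi_2\in\mathrm{Asg}(P)$, $p\in P$, $k\in\mathbb N$: $\chi_1\approx^{>k}_p\chi_2$ iff $\chi_1(q)=\chi_2(q)$ for all $q\in P\setminus\{p\}$ and $\chi_1(p)(t)=\chi_2(p)(t)$ for all $t\le k$; $\chi_1\approx^{\ge k}_p\chi_2$ is defined the same way with $t<k$ in place of $t\le k$. $F\in\mathrm{Fnc}(P)$ is behavioral (resp. strongly behavioral) w.r.t. $p\in P$ if $F(\chi_1)(k)=F(\chi_2)(k)$ for all $k\in\mathbb N$ and all $\chi_1,\chi_2$ with $\chi_1\approx^{>k}_p\chi_2$ (resp. $\chi_1\approx^{\ge k}_p\chi_2$). A quantifier specification is a pair $\sigma=\langle P_B,P_S\rangle$ of subsets of $AP$; $\mathrm{Fnc}_\sigma(P)$ is the set of $F\in\mathrm{Fnc}(P)$ that are behavioral w.r.t. every $p\in P_B\cap P$ and strongly behavioral w.r.t. every $p\in P_S\cap P$. $\mathrm{ext}_\sigma(\mathcal X,p)=\{\mathrm{ext}(X,F,p):X\in\mathcal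 X,\ F\in\mathrm{Fnc}_\sigma(\mathrm{ap}(\mathcal X))\}$. GFG-QPTL formulas are generated by $\varphi::=\psi\mid\neg\varphi\mid\varphi\wedge\varphi\mid\varphi\vee\varphi\mid\exists p{:}\sigma.\varphi\mid\forall p{:}\sigma.\varphi$, where $\psi$ is an LTL formula over $AP$, $p\in AP$ and $\sigma$ a quantifier specification; we also write $\exists^\sigma p.\varphi$, $\forall^\sigma p.\varphi$. QPTL formulas are those in which every specification is $\langle\emptyset,\emptyset\rangle$. $\mathrm{free}(\varphi)$ is the set of free propositions. $\chi\models_{LTL}\psi$ iff the infinite word whose $t$-th letter is the valuation $q\mapsto\chi(q)(t)$ satisfies $\psi$ in the standard LTL sense. Alternation flags are $\exists\forall$ and $\forall\exists$; $\bar\alpha$ is the flag different from $\alpha$. For a GFG-QPTL formula $\varphi$, $\mathcal X\in\mathrm{HAsg}_\supseteq(\mathrm{free}(\varphi))$ and flag $\alpha$, $\mathcal X\models^\alpha\varphi$ is defined inductively: (1) for LTL $\psi$: $\mathcal X\models^{\exists\forall}\psi$ iff there is $X\in\mathcal X$ with $\chi\models_{LTL}\psi$ for all $\chi\in X$; $\mathcal X\models^{\forall\exists}\psi$ iff for every $X\in\mathcal X$ there is $\chi\in X$ with $\chi\models_{LTL}\psi$; (2) $\mathcal X\models^\alpha\neg\phi$ iff not $\mathcal X\models^{\bar\alpha}\phi$; (3) $\mathcal X\models^{\exists\forall}\phi_1\wedge\phi_2$ iff for every $(\mathcal X_1,\mathcal X_2)\in\mathrm{par}(\mathcal X)$, either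 ($\mathcal X_1\ne\emptyset$ and $\mathcal X_1\models^{\exists\forall}\phi_1$) or ($\mathcal X_2\ne\emptyset$ and $\mathcal X_2\models^{\exists\forall}\phi_2$); $\mathcal X\models^{\forall\exists}\phi_1\wedge\phi_2$ iff $\overline{\mathcal X}\models^{\exists\forall}\phi_1\wedge\phi_2$; (4) $\mathcal X\models^{\forall\exists}\phi_1\vee\phi_2$ iff there is $(\mathcal X_1,\mathcal X_2)\in\mathrm{par}(\mathcal X)$ such that ($\mathcal X_1\neq\emptyset$ implies $\mathcal X_1\models^{\forall\exists}\phi_1$) and ($\mathcal X_2\neq\emptyset$ implies $\mathcal X_2\models^{\forall\exists}\phi_2$); $\mathcal X\models^{\exists\forall}\phi_1\vee\phi_2$ iff $\overline{\mathcal X}\models^{\forall\exists}\phi_1\vee\phi_2$; (5) $\mathcal X\models^{\exists\forall}\exists p{:}\sigma.\phi$ iff $\mathrm{ext}_\sigma(\mathcal X,p)\models^{\exists\forall}\phi$; $\mathcal X\models^{\forall\exists}\exists p{:}\sigma.\phi$ iff $\overline{\mathcal X}\models^{\exists\forall}\exists p{:}\sigma.\phi$; (6) $\mathcal X\models^{\forall\exists}\forall p{:}\sigma.\phi$ iff $\mathrm{ext}_\sigma(\mathcal X,p)\models^{\forall\exists}\phi$; $\mathcal X\models^{\exists\forall}\forall p{:}\sigma.\phi$ iff $\overline{\mathcal X}\models^{\forall\exists}\forall p{:}\sigma.\phi$. -}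

module Defs where

open import Axiom.ExcludedMiddle using (ExcludedMiddle)
open import Axiom.Extensionality.Propositional using (Extensionality)
open import Data.Bool using (Bool; true; false; T)
open import Data.Maybe using (Maybe; just; maybe′; Is-just)
open import Data.Nat using (ℕ; suc; _≤_; _<_)
open import Data.Product using (∃; _×_; _,_; proj₁; proj₂)
open import Data.Sum using (_⊎_)
open import Data.Unit using () renaming (⊤ to Unit)
open import Level using (Lift; 0ℓ) renaming (suc to lsuc)
open import Relation.Binary.Definitions using (DecidableEquality)
open import Relation.Binary.PropositionalEquality using (_≡_; _≢_; refl; sym; subst)
open import Relation.Nullary using (¬_; yes; no; contradiction)
open import Relation.Unary
  using (Pred; _∈_; _∉_; _⊆_; _≐_; _∪_; _⊥_; Satisfiable)

-- The development is read in classical, extensional mathematics; theorems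
-- about it take ExcludedMiddle and Extensionality as hypotheses. Since the
-- library's ExcludedMiddle decides arbitrary (untruncated) types, it also
-- yields the choice functions used below.

-- The powerset 2^A, as characteristic functions, so that it is again small
-- and, under Extensionality, sets with the same elements are equal.
𝒫 : Set → Set
𝒫 A = A → Bool

⟦_⟧ : {A : Set} → 𝒫 A → Pred A 0ℓ
⟦ X ⟧ a = T (X a)

∅ : {A : Set} → 𝒫 A
∅ _ = false

data Flag : Set where
  ∃∀ ∀∃ : Flag

dualFlag : Flag → Flag
dualFlag ∃∀ = ∀∃
dualFlag ∀∃ = ∃∀

module GFG-QPTL (AP : Set) (_≟_ : DecidableEquality AP) where

  -- The remaining Boolean and temporal operators are the usual abbreviations.
  data LTL : Set where
    true′  : LTL
    atom   : AP → LTL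
    not    : LTL → LTL
    _and_  : LTL → LTL → LTL
    _or_   : LTL → LTL → LTL
    next   : LTL → LTL
    _until_ : LTL → LTL → LTL

  -- w at i ⊨LTL ψ : the suffix of the word w starting at position i satisfies ψ.
  _at_⊨LTL_ : (ℕ → AP → Bool) → ℕ → LTL → Set
  w at i ⊨LTL true′       = Unit
  w at i ⊨LTL atom p      = T (w i p)
  w at i ⊨LTL not ψ       = ¬ (w at i ⊨LTL ψ)
  w at i ⊨LTL (ψ₁ and ψ₂) = (w at i ⊨LTL ψ₁) × (w at i ⊨LTL ψ₂)
  w at i ⊨LTL (ψ₁ or ψ₂)  = (w at i ⊨LTL ψ₁) ⊎ (w at i ⊨LTL ψ₂)
  w at i ⊨LTL next ψ      = w at suc i ⊨LTL ψ
  w at i ⊨LTL (ψ₁ until ψ₂) =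
    ∃ λ k → i ≤ k × (w at k ⊨LTL ψ₂) ×
            (∀ j → i ≤ j → j < k → w at j ⊨LTL ψ₁)

  atoms : LTL → Pred AP 0ℓ
  atoms true′         q = q ∈ ⟦ ∅ ⟧
  atoms (atom p)      q = q ≡ p
  atoms (not ψ)         = atoms ψ
  atoms (ψ₁ and ψ₂)     = atoms ψ₁ ∪ atoms ψ₂
  atoms (ψ₁ or ψ₂)      = atoms ψ₁ ∪ atoms ψ₂
  atoms (next ψ)        = atoms ψ
  atoms (ψ₁ until ψ₂)   = atoms ψ₁ ∪ atoms ψ₂

  record Spec : Set₁ where
    constructor ⟨_,_⟩
    field
      P-B P-S : Pred AP 0ℓ

  data Formula : Set₁ where
    ltl    : LTL → Formula
    ¬̇_     : Formula → Formula
    _∧̇_    : Formula → Formula → Formula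
    _∨̇_    : Formula → Formula → Formula
    ∃̇_∶_∙_ : AP → Spec → Formula → Formula
    ∀̇_∶_∙_ : AP → Spec → Formula → Formula

  free : Formula → Pred AP 0ℓ
  free (ltl ψ)       = atoms ψ
  free (¬̇ φ)         = free φ
  free (φ₁ ∧̇ φ₂)     = free φ₁ ∪ free φ₂
  free (φ₁ ∨̇ φ₂)     = free φ₁ ∪ free φ₂
  free (∃̇ p ∶ σ ∙ φ) = λ q → q ∈ free φ × q ≢ p
  free (∀̇ p ∶ σ ∙ φ) = λ q → q ∈ free φ × q ≢ p

  TVal : Set
  TVal = ℕ → Bool

  Asg : Set
  Asg = AP → Maybe TVal

  dom : Asg → Pred AP 0ℓ
  dom χ p = Is-just (χ p)

  Asg[_] : Pred AP 0ℓ → Pred Asg 0ℓ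
  Asg[ P ] χ = dom χ ≐ P

  -- χ(p)(t), with the junk value false when χ(p) is undefined.
  val : Asg → AP → TVal
  val χ p t = maybe′ (λ f → f t) false (χ p)

  _[_↦_] : Asg → AP → TVal → Asg
  (χ [ p ↦ f ]) q with q ≟ p
  ... | yes _ = just f
  ... | no  _ = χ q

  _⊨LTL_ : Asg → LTL → Set
  χ ⊨LTL ψ = (λ t q → val χ q t) at 0 ⊨LTL ψ

  SetOfSets : Set₁
  SetOfSets = Pred (𝒫 Asg) 0ℓ

  record HAsg (P : Pred AP 0ℓ) (𝒳 : SetOfSets) : Set where
    field
      nonempty : Satisfiable 𝒳
      ⊆2^Asg   : ∀ {X} → X ∈ 𝒳 → ⟦ X ⟧ ⊆ Asg[ P ]
      ∅∉       : ∅ ∉ 𝒳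

  HAsg⊇ : Pred AP 0ℓ → SetOfSets → Set₁
  HAsg⊇ P 𝒳 = ∃ λ Q → HAsg Q 𝒳 × P ⊆ Q

  -- The common domain of the assignments in 𝒳; by ap-HAsg below this is
  -- the P with 𝒳 ∈ HAsg(P).
  ap : SetOfSets → Pred AP 0ℓ
  ap 𝒳 p = ∃ λ X → X ∈ 𝒳 × ∃ λ χ → χ ∈ ⟦ X ⟧ × p ∈ dom χ

  ap-HAsg : ExcludedMiddle 0ℓ → Extensionality 0ℓ 0ℓ →
            ∀ {P 𝒳} → HAsg P 𝒳 → ap 𝒳 ≐ P
  ap-HAsg em ext {P} {𝒳} h = ap⊆P , P⊆ap
    where
    open HAsg h
    ap⊆P : ap 𝒳 ⊆ P
    ap⊆P (X , X∈𝒳 , χ , χ∈X , p∈χ) = proj₁ (⊆2^Asg X∈𝒳 χ∈X) p∈χ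
    member : ∀ X → X ∈ 𝒳 → Satisfiable ⟦ X ⟧
    member X X∈𝒳 with em {P = Satisfiable ⟦ X ⟧}
    ... | yes s = s
    ... | no ¬s = contradiction (subst 𝒳 (ext X≗∅) X∈𝒳) ∅∉
      where
      X≗∅ : ∀ χ → X χ ≡ false
      X≗∅ χ with X χ in eq
      ... | false = refl
      ... | true  = contradiction (χ , subst T (sym eq) _) ¬s
    P⊆ap : P ⊆ ap 𝒳
    P⊆ap p∈P with nonempty
    ... | X , X∈𝒳 with member X X∈𝒳
    ... | χ , χ∈X = X , X∈𝒳 , χ , χ∈X , proj₂ (⊆2^Asg X∈𝒳 χ∈X) p∈P

  -- A choice function is given by a total c, of which only the values on 𝒳
  -- matter; thus c(X) cannot depend on the proof of X ∈ 𝒳.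
  IsChoice : SetOfSets → (𝒫 Asg → Asg) → Set
  IsChoice 𝒳 c = ∀ X → X ∈ 𝒳 → c X ∈ ⟦ X ⟧

  img : SetOfSets → (𝒫 Asg → Asg) → Pred Asg 0ℓ
  img 𝒳 c χ = ∃ λ X → X ∈ 𝒳 × c X ≡ χ

  dual : SetOfSets → SetOfSets
  dual 𝒳 Y = ∃ λ c → IsChoice 𝒳 c × ⟦ Y ⟧ ≐ img 𝒳 c

  par : SetOfSets → SetOfSets → SetOfSets → Set
  par 𝒳 𝒳₁ 𝒳₂ = 𝒳₁ ⊥ 𝒳₂ × 𝒳₁ ∪ 𝒳₂ ≐ 𝒳

  -- Functors over P are given by total functions on Asg, of which only the
  -- values on Asg[ P ] matter: the conditions below inspect F there only.
  Functor : Set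
  Functor = Asg → TVal

  _≈[>_]⟨_,_⟩_ : Asg → ℕ → Pred AP 0ℓ → AP → Asg → Set
  χ₁ ≈[> k ]⟨ P , p ⟩ χ₂ =
    (∀ q → q ∈ P → q ≢ p → χ₁ q ≡ χ₂ q) ×
    (∀ t → t ≤ k → val χ₁ p t ≡ val χ₂ p t)

  _≈[≥_]⟨_,_⟩_ : Asg → ℕ → Pred AP 0ℓ → AP → Asg → Set
  χ₁ ≈[≥ k ]⟨ P , p ⟩ χ₂ =
    (∀ q → q ∈ P → q ≢ p → χ₁ q ≡ χ₂ q) ×
    (∀ t → t < k → val χ₁ p t ≡ val χ₂ p t)

  Behavioral : Pred AP 0ℓ → AP → Functor → Set
  Behavioral P p F =
    ∀ k χ₁ χ₂ → χ₁ ∈ Asg[ P ] → χ₂ ∈ Asg[ P ] →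
    χ₁ ≈[> k ]⟨ P , p ⟩ χ₂ → F χ₁ k ≡ F χ₂ k

  StronglyBehavioral : Pred AP 0ℓ → AP → Functor → Set
  StronglyBehavioral P p F =
    ∀ k χ₁ χ₂ → χ₁ ∈ Asg[ P ] → χ₂ ∈ Asg[ P ] →
    χ₁ ≈[≥ k ]⟨ P , p ⟩ χ₂ → F χ₁ k ≡ F χ₂ k

  Fnc : Spec → Pred AP 0ℓ → Pred Functor 0ℓ
  Fnc σ P F =
    (∀ p → p ∈ P-B → p ∈ P → Behavioral P p F) ×
    (∀ p → p ∈ P-S → p ∈ P → StronglyBehavioral P p F)
    where open Spec σ

  extAsg : Asg → Functor → AP → Asg
  extAsg χ F p = χ [ p ↦ F χ ]

  extSet : 𝒫 Asg → Functor → AP → Pred Asg 0ℓ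
  extSet X F p χ′ = ∃ λ χ → χ ∈ ⟦ X ⟧ × χ′ ≡ extAsg χ F p

  extσ : Spec → SetOfSets → AP → SetOfSets
  extσ σ 𝒳 p Y =
    ∃ λ X → X ∈ 𝒳 × ∃ λ F → F ∈ Fnc σ (ap 𝒳) × ⟦ Y ⟧ ≐ extSet X F p

  -- The clauses for ∧ under ∃∀ and for ∨ under ∀∃, given the meanings of
  -- the two immediate subformulas under the same flag.
  conj disj : Pred SetOfSets (lsuc 0ℓ) → Pred SetOfSets (lsuc 0ℓ) →
              Pred SetOfSets (lsuc 0ℓ)
  conj S₁ S₂ 𝒳 = ∀ 𝒳₁ 𝒳₂ → par 𝒳 𝒳₁ 𝒳₂ →
    (Satisfiable 𝒳₁ × S₁ 𝒳₁) ⊎ (Satisfiable 𝒳₂ × S₂ 𝒳₂)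
  disj S₁ S₂ 𝒳 = ∃ λ 𝒳₁ → ∃ λ 𝒳₂ → par 𝒳 𝒳₁ 𝒳₂ ×
    (Satisfiable 𝒳₁ → S₁ 𝒳₁) × (Satisfiable 𝒳₂ → S₂ 𝒳₂)

  -- Clauses that pass to the dual and flip the flag without changing the
  -- formula are unfolded once, so that the recursion is structural. The
  -- relation is only of interest on hyperassignments over supersets of the
  -- free propositions.
  infix 3 _⊨[_]_
  _⊨[_]_ : SetOfSets → Flag → Formula → Set₁
  𝒳 ⊨[ ∃∀ ] ltl ψ = Lift _ (∃ λ X → X ∈ 𝒳 × (∀ χ → χ ∈ ⟦ X ⟧ → χ ⊨LTL ψ))
  𝒳 ⊨[ ∀∃ ] ltl ψ = Lift _ (∀ X → X ∈ 𝒳 → ∃ λ χ → χ ∈ ⟦ X ⟧ × χ ⊨LTL ψ)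
  𝒳 ⊨[ α  ] (¬̇ φ) = ¬ (𝒳 ⊨[ dualFlag α ] φ)
  𝒳 ⊨[ ∃∀ ] (φ₁ ∧̇ φ₂) = conj (_⊨[ ∃∀ ] φ₁) (_⊨[ ∃∀ ] φ₂) 𝒳
  𝒳 ⊨[ ∀∃ ] (φ₁ ∧̇ φ₂) = conj (_⊨[ ∃∀ ] φ₁) (_⊨[ ∃∀ ] φ₂) (dual 𝒳)
  𝒳 ⊨[ ∀∃ ] (φ₁ ∨̇ φ₂) = disj (_⊨[ ∀∃ ] φ₁) (_⊨[ ∀∃ ] φ₂) 𝒳
  𝒳 ⊨[ ∃∀ ] (φ₁ ∨̇ φ₂) = disj (_⊨[ ∀∃ ] φ₁) (_⊨[ ∀∃ ] φ₂) (dual 𝒳)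
  𝒳 ⊨[ ∃∀ ] (∃̇ p ∶ σ ∙ φ) = extσ σ 𝒳 p ⊨[ ∃∀ ] φ
  𝒳 ⊨[ ∀∃ ] (∃̇ p ∶ σ ∙ φ) = extσ σ (dual 𝒳) p ⊨[ ∃∀ ] φ
  𝒳 ⊨[ ∀∃ ] (∀̇ p ∶ σ ∙ φ) = extσ σ 𝒳 p ⊨[ ∀∃ ] φ
  𝒳 ⊨[ ∃∀ ] (∀̇ p ∶ σ ∙ φ) = extσ σ (dual 𝒳) p ⊨[ ∀∃ ] φ

{-# OPTIONS --safe #-}

-- Order hyperassignments by 𝒳 ⊑ 𝒳′ when every member of 𝒳 includes a member
-- of 𝒳′. Every clause of the semantics respects this order, so satisfaction
-- is monotone under ∃∀ and antitone under ∀∃. By the axiom of choice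
-- 𝒳 ⊑ dual (dual 𝒳) ⊑ 𝒳, which gives the invariance under double dualisation.
-- The exchange of flags then holds by definition or by that invariance
-- except for LTL formulas, where it is Skolemisation, and negation, where it
-- is the induction hypothesis.

module Submission where

open import Defs
open import Axiom.ExcludedMiddle using (ExcludedMiddle)
open import Axiom.Extensionality.Propositional using (Extensionality)
open import Data.Bool using (true; false)
open import Data.Empty using (⊥-elim)
open import Data.Maybe using (nothing)
open import Data.Maybe.Relation.Unary.Any using (just)
open import Data.Product using (∃; _×_; _,_; proj₁; proj₂)
open import Data.Sum as Sum using (inj₁; inj₂)
open import Function.Base using (_∘_)
open import Function.Bundles using (_⇔_; mk⇔)
open import Function.Construct.Composition using (_⇔-∘_)
open import Function.Construct.Identity using (⇔-id)
open import Function.Construct.Symmetry using (⇔-sym)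
open import Function.Related.TypeIsomorphisms using (¬-cong-⇔)
open import Level using (0ℓ; lift) renaming (suc to lsuc)
open import Relation.Binary.PropositionalEquality using (_≡_; refl; sym; subst)
open import Relation.Nullary using (yes; no; contradiction)
open import Relation.Nullary.Decidable
  using (isYes; toWitness; fromWitness; decidable-stable)
open import Relation.Nullary.Negation using (contraposition)
open import Relation.Unary
  using (Pred; _∈_; _∉_; _⊆_; _≐_; _∪_; _∩_; ∁; Satisfiable)
open import Relation.Unary.Properties using (≐-sym; ≐-trans)

module DualInvariance
  (em : ExcludedMiddle 0ℓ) (ext : Extensionality 0ℓ 0ℓ) (AP : Set) where

  open GFG-QPTL AP (λ _ _ → em)

  private variable
    P Q : Pred AP 0ℓ
    𝒳 𝒳′ 𝒴₁ 𝒴₂ : SetOfSets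
    X : 𝒫 Asg

  -- Characteristic functions and choice from excluded middle

  ⌜_⌝ : Pred Asg 0ℓ → 𝒫 Asg
  ⌜ A ⌝ χ = isYes (em {P = A χ})

  ⌜⌝-≐ : (A : Pred Asg 0ℓ) → ⟦ ⌜ A ⌝ ⟧ ≐ A
  ⌜⌝-≐ A = toWitness , fromWitness

  -- All choice functions below are built with this: it is total and depends on `X` alone, as
  -- `IsChoice` demands. `R X` prescribes the admissible values; the nowhere defined assignment is
  -- the default when there are none.
  select : (𝒫 Asg → Pred Asg 0ℓ) → 𝒫 Asg → Asg
  select R X with em {P = Satisfiable (R X)}
  ... | yes (χ , _) = χ
  ... | no  _       = λ _ → nothing

  select-∈ : ∀ R → Satisfiable (R X) → select R X ∈ R X
  select-∈ {X} R s with em {P = Satisfiable (R X)}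
  ... | yes (_ , χ∈) = χ∈
  ... | no  ¬s       = contradiction s ¬s

  -- Hyperassignments under dualisation, subfamilies and extension

  member : HAsg P 𝒳 → X ∈ 𝒳 → Satisfiable ⟦ X ⟧
  member {𝒳 = 𝒳} {X = X} h X∈𝒳 = decidable-stable em λ ¬s →
    HAsg.∅∉ h (subst 𝒳 (ext λ χ → empty χ λ χ∈X → ¬s (χ , χ∈X)) X∈𝒳)
    where
    empty : ∀ χ → χ ∉ ⟦ X ⟧ → X χ ≡ false
    empty χ χ∉X with X χ
    ... | false = refl
    ... | true  = contradiction _ χ∉X

  image : SetOfSets → (𝒫 Asg → Asg) → 𝒫 Asg
  image 𝒳 c = ⌜ img 𝒳 c ⌝

  image-∈ : ∀ {c} → IsChoice 𝒳 c → image 𝒳 c ∈ dual 𝒳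
  image-∈ {𝒳} {c} ch = c , ch , ⌜⌝-≐ (img 𝒳 c)

  dual-HAsg : HAsg P 𝒳 → HAsg P (dual 𝒳)
  dual-HAsg {𝒳 = 𝒳} h = record
    { nonempty = image 𝒳 (select ⟦_⟧) , image-∈ λ X → select-∈ ⟦_⟧ ∘ member h
    ; ⊆2^Asg   = λ (c , ch , Y⊆ , _) χ∈Y → inside ch (Y⊆ χ∈Y)
    ; ∅∉       = λ (c , ch , _ , Y⊇) → Y⊇ (X₀ , X₀∈𝒳 , refl)
    }
    where
    open HAsg h
    X₀   = proj₁ nonempty
    X₀∈𝒳 = proj₂ nonempty
    inside : ∀ {c χ} → IsChoice 𝒳 c → χ ∈ img 𝒳 c → χ ∈ Asg[ _ ]
    inside ch (X , X∈𝒳 , refl) = ⊆2^Asg X∈𝒳 (ch X X∈𝒳)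

  subset-HAsg : HAsg P 𝒳 → 𝒳′ ⊆ 𝒳 → Satisfiable 𝒳′ → HAsg P 𝒳′
  subset-HAsg h 𝒳′⊆𝒳 s = record
    { nonempty = s
    ; ⊆2^Asg   = HAsg.⊆2^Asg h ∘ 𝒳′⊆𝒳
    ; ∅∉       = HAsg.∅∉ h ∘ 𝒳′⊆𝒳
    }

  dom-update : ∀ χ p f → dom (χ [ p ↦ f ]) ≐ dom χ ∪ (_≡ p)
  dom-update χ p f = to , from
    where
    to : dom (χ [ p ↦ f ]) ⊆ dom χ ∪ (_≡ p)
    to {q} q∈ with em {P = q ≡ p}
    ... | yes q≡p = inj₂ q≡p
    ... | no  _   = inj₁ q∈
    from : dom χ ∪ (_≡ p) ⊆ dom (χ [ p ↦ f ])
    from {q} q∈ with em {P = q ≡ p} | q∈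
    ... | yes _ | _         = just _
    ... | no _  | inj₁ q∈χ  = q∈χ
    ... | no ¬e | inj₂ q≡p  = contradiction q≡p ¬e

  update-Asg : ∀ {χ} p f → χ ∈ Asg[ P ] → χ [ p ↦ f ] ∈ Asg[ P ∪ (_≡ p) ]
  update-Asg {χ = χ} p f (χ⊆ , χ⊇) =
    ≐-trans (dom-update χ p f) (Sum.map₁ χ⊆ , Sum.map₁ χ⊇)

  extσ-HAsg : ∀ σ p → HAsg P 𝒳 → HAsg (P ∪ (_≡ p)) (extσ σ 𝒳 p)
  extσ-HAsg {𝒳 = 𝒳} σ p h = record
    { nonempty = ⌜ extSet X₀ F₀ p ⌝ , X₀ , X₀∈𝒳 , F₀ ,
                 ((λ _ _ _ _ _ _ _ _ _ → refl) , (λ _ _ _ _ _ _ _ _ _ → refl)) ,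
                 ⌜⌝-≐ (extSet X₀ F₀ p)
    ; ⊆2^Asg   = λ (X , X∈𝒳 , F , _ , Y⊆ , _) χ∈Y → inside X∈𝒳 (Y⊆ χ∈Y)
    ; ∅∉       = λ (X , X∈𝒳 , F , _ , _ , Y⊇) →
                   Y⊇ (_ , proj₂ (member h X∈𝒳) , refl)
    }
    where
    open HAsg h
    X₀   = proj₁ nonempty
    X₀∈𝒳 = proj₂ nonempty
    -- A constant functor satisfies every quantifier specification.
    F₀ : Functor
    F₀ _ _ = false
    inside : ∀ {X F χ} → X ∈ 𝒳 → χ ∈ extSet X F p → χ ∈ Asg[ _ ]
    inside X∈𝒳 (χ , χ∈X , refl) = update-Asg p _ (⊆2^Asg X∈𝒳 χ∈X)

  -- `extσ` draws its functors from `Fnc σ (ap 𝒳)`. For two hyperassignments over the same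
  -- propositions, the two `ap` are known to agree only up to `≐`.
  Fnc-resp-≐ : ∀ σ → P ≐ Q → Fnc σ P ⊆ Fnc σ Q
  Fnc-resp-≐ σ (P⊆Q , Q⊆P) (b , s) =
    (λ p p∈B p∈Q k χ₁ χ₂ D₁ D₂ (e , v) →
      b p p∈B (Q⊆P p∈Q) k χ₁ χ₂ (dom≐ D₁) (dom≐ D₂) ((λ q → e q ∘ P⊆Q) , v)) ,
    (λ p p∈S p∈Q k χ₁ χ₂ D₁ D₂ (e , v) →
      s p p∈S (Q⊆P p∈Q) k χ₁ χ₂ (dom≐ D₁) (dom≐ D₂) ((λ q → e q ∘ P⊆Q) , v))
    where
    dom≐ : ∀ {χ} → χ ∈ Asg[ _ ] → χ ∈ Asg[ _ ]
    dom≐ D = ≐-trans D (Q⊆P , P⊆Q)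

  -- The order and its interaction with the dual

  infix 4 _⊑_
  _⊑_ : SetOfSets → SetOfSets → Set
  𝒳 ⊑ 𝒳′ = ∀ {X} → X ∈ 𝒳 → ∃ λ X′ → X′ ∈ 𝒳′ × ⟦ X′ ⟧ ⊆ ⟦ X ⟧

  ⊑-satisfiable : 𝒳 ⊑ 𝒳′ → Satisfiable 𝒳 → Satisfiable 𝒳′
  ⊑-satisfiable 𝒳⊑𝒳′ (_ , X∈𝒳) = let X′ , X′∈𝒳′ , _ = 𝒳⊑𝒳′ X∈𝒳 in X′ , X′∈𝒳′

  -- Each `X` in `𝒳` includes some `X′` in `𝒳′`, so `c′ X′` lies both in `X` and in the image of
  -- `c′`. Choosing from that intersection keeps the new image inside `Y`.
  dual-antitone : 𝒳 ⊑ 𝒳′ → dual 𝒳′ ⊑ dual 𝒳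
  dual-antitone {𝒳} {𝒳′} 𝒳⊑𝒳′ {Y} (c′ , ch′ , _ , Y⊇) =
    image 𝒳 c , image-∈ (λ X X∈𝒳 → proj₁ (c-∈ X∈𝒳)) ,
    λ χ∈ → inside (proj₁ (⌜⌝-≐ (img 𝒳 c)) χ∈)
    where
    R : 𝒫 Asg → Pred Asg 0ℓ
    R X = ⟦ X ⟧ ∩ img 𝒳′ c′
    c = select R
    c-∈ : ∀ {X} → X ∈ 𝒳 → c X ∈ R X
    c-∈ X∈𝒳 with 𝒳⊑𝒳′ X∈𝒳
    ... | X′ , X′∈𝒳′ , X′⊆X =
      select-∈ R (c′ X′ , X′⊆X (ch′ X′ X′∈𝒳′) , X′ , X′∈𝒳′ , refl)
    inside : img 𝒳 c ⊆ ⟦ Y ⟧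
    inside (X , X∈𝒳 , refl) = Y⊇ (proj₂ (c-∈ X∈𝒳))

  -- Every member of the dual is the image of some `c` and so contains `c X`, a point of `X`.
  -- Choosing such common points gives an image inside `X`.
  ⊑-dual² : 𝒳 ⊑ dual (dual 𝒳)
  ⊑-dual² {𝒳} {X} X∈𝒳 =
    image (dual 𝒳) d , image-∈ (λ Y Y∈ → proj₁ (d-∈ Y∈)) ,
    λ χ∈ → inside (proj₁ (⌜⌝-≐ (img (dual 𝒳) d)) χ∈)
    where
    R : 𝒫 Asg → Pred Asg 0ℓ
    R Y = ⟦ Y ⟧ ∩ ⟦ X ⟧
    d = select R
    d-∈ : ∀ {Y} → Y ∈ dual 𝒳 → d Y ∈ R Y
    d-∈ (c , ch , _ , Y⊇) = select-∈ R (c X , Y⊇ (X , X∈𝒳 , refl) , ch X X∈𝒳)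
    inside : img (dual 𝒳) d ⊆ ⟦ X ⟧
    inside (Y , Y∈ , refl) = proj₂ (d-∈ Y∈)

  -- By contraposition: if no `X` lies inside `A`, choose a point outside `A` from each `X`; the
  -- image is a member of the dual that misses `A`.
  all-hit⇒∃⊆ : (A : Pred Asg 0ℓ) →
    (∀ {Y} → Y ∈ dual 𝒳 → Satisfiable (⟦ Y ⟧ ∩ A)) →
    ∃ λ X → X ∈ 𝒳 × ⟦ X ⟧ ⊆ A
  all-hit⇒∃⊆ {𝒳} A hits =
    decidable-stable (em {P = ∃ λ X → X ∈ 𝒳 × ⟦ X ⟧ ⊆ A}) λ none →
    let avoid : ∀ X → X ∈ 𝒳 → Satisfiable (R X)
        avoid X X∈𝒳 = decidable-stable em λ ¬s →
          none (X , X∈𝒳 , λ χ∈X → decidable-stable em λ χ∉A → ¬s (_ , χ∈X , χ∉A))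
        c-∈ : ∀ X → X ∈ 𝒳 → c X ∈ R X
        c-∈ X X∈𝒳 = select-∈ R (avoid X X∈𝒳)
        χ , χ∈Y , χ∈A = hits (image-∈ {c = c} (λ X X∈𝒳 → proj₁ (c-∈ X X∈𝒳)))
        X , X∈𝒳 , cX≡χ = proj₁ (⌜⌝-≐ (img 𝒳 c)) χ∈Y
    in proj₂ (c-∈ X X∈𝒳) (subst A (sym cX≡χ) χ∈A)
    where
    R : 𝒫 Asg → Pred Asg 0ℓ
    R X = ⟦ X ⟧ ∩ ∁ A
    c = select R

  -- `Z` is the image of a choice function for the dual, so it meets every member of the dual.
  dual²-⊑ : dual (dual 𝒳) ⊑ 𝒳
  dual²-⊑ {𝒳} {Z} (d , ch , _ , Z⊇) = all-hit⇒∃⊆ ⟦ Z ⟧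
    λ {Y} Y∈ → d Y , ch Y Y∈ , Z⊇ (Y , Y∈ , refl)

  -- Extensions and partitions along the order

  extσ-monotone : ∀ σ p → HAsg P 𝒳 → HAsg P 𝒳′ →
    𝒳 ⊑ 𝒳′ → extσ σ 𝒳 p ⊑ extσ σ 𝒳′ p
  extσ-monotone σ p h h′ 𝒳⊑𝒳′ (X , X∈𝒳 , F , F∈ , _ , Y⊇) with 𝒳⊑𝒳′ X∈𝒳
  ... | X′ , X′∈𝒳′ , X′⊆X =
    ⌜ extSet X′ F p ⌝ ,
    -- The functor that extends `X` is reused for `X′`; extension acts pointwise, so it preserves
    -- the inclusion.
    (X′ , X′∈𝒳′ , F , Fnc-resp-≐ σ same-ap F∈ , ⌜⌝-≐ (extSet X′ F p)) ,
    λ χ∈ → let χ₀ , χ₀∈X′ , eq = proj₁ (⌜⌝-≐ (extSet X′ F p)) χ∈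
           in Y⊇ (χ₀ , X′⊆X χ₀∈X′ , eq)
    where
    same-ap = ≐-trans (ap-HAsg em ext h) (≐-sym (ap-HAsg em ext h′))

  -- Pulls a partition back along the order. Sets that include a member of `𝒴₁` form the first part,
  -- even if they also include one of `𝒴₂`; for any other set, the `X′` below it must lie in `𝒴₂`.
  par-⊑ : 𝒳 ⊑ 𝒳′ → par 𝒳′ 𝒴₁ 𝒴₂ →
    ∃ λ 𝒳₁ → ∃ λ 𝒳₂ → par 𝒳 𝒳₁ 𝒳₂ × 𝒳₁ ⊑ 𝒴₁ × 𝒳₂ ⊑ 𝒴₂
  par-⊑ {𝒳} {𝒳′} {𝒴₁} {𝒴₂} 𝒳⊑𝒳′ (_ , _ , 𝒳′⊆) =
    𝒳 ∩ Above , 𝒳 ∩ ∁ Above ,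
    ((λ ((_ , above) , (_ , ¬above)) → ¬above above) ,
     (λ { (inj₁ (X∈𝒳 , _)) → X∈𝒳 ; (inj₂ (X∈𝒳 , _)) → X∈𝒳 }) , cover) ,
    proj₂ , below₂
    where
    Above : SetOfSets
    Above X = ∃ λ Y → Y ∈ 𝒴₁ × ⟦ Y ⟧ ⊆ ⟦ X ⟧
    cover : 𝒳 ⊆ (𝒳 ∩ Above) ∪ (𝒳 ∩ ∁ Above)
    cover {X} X∈𝒳 with em {P = X ∈ Above}
    ... | yes above = inj₁ (X∈𝒳 , above)
    ... | no ¬above = inj₂ (X∈𝒳 , ¬above)
    below₂ : 𝒳 ∩ ∁ Above ⊑ 𝒴₂
    below₂ (X∈𝒳 , ¬above) with 𝒳⊑𝒳′ X∈𝒳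
    ... | X′ , X′∈𝒳′ , X′⊆X with 𝒳′⊆ X′∈𝒳′
    ... | inj₁ X′∈𝒴₁ = ⊥-elim (¬above (X′ , X′∈𝒴₁ , X′⊆X))
    ... | inj₂ X′∈𝒴₂ = X′ , X′∈𝒴₂ , X′⊆X

  -- Monotonicity of the semantic clauses and of satisfaction

  Monotone Antitone : Pred SetOfSets (lsuc 0ℓ) → Set₁
  Monotone S = ∀ {P 𝒳 𝒳′} → HAsg P 𝒳 → HAsg P 𝒳′ → 𝒳 ⊑ 𝒳′ → S 𝒳 → S 𝒳′
  Antitone S = ∀ {P 𝒳 𝒳′} → HAsg P 𝒳 → HAsg P 𝒳′ → 𝒳 ⊑ 𝒳′ → S 𝒳′ → S 𝒳

  module _ {S₁ S₂ : Pred SetOfSets (lsuc 0ℓ)} where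

    -- A partition of `𝒳′` is pulled back to `𝒳`; whichever disjunct holds there moves up,
    -- nonemptiness included.
    conj-monotone : Monotone S₁ → Monotone S₂ → Monotone (conj S₁ S₂)
    conj-monotone m₁ m₂ h h′ 𝒳⊑𝒳′ all 𝒴₁ 𝒴₂ π@(_ , 𝒴⊆ , _)
      with par-⊑ 𝒳⊑𝒳′ π
    ... | 𝒳₁ , 𝒳₂ , π₀@(_ , 𝒳⊆ , _) , ⊑₁ , ⊑₂ =
      Sum.map (transfer (𝒳⊆ ∘ inj₁) (𝒴⊆ ∘ inj₁) m₁ ⊑₁)
              (transfer (𝒳⊆ ∘ inj₂) (𝒴⊆ ∘ inj₂) m₂ ⊑₂)
              (all 𝒳₁ 𝒳₂ π₀)
      where
      transfer : ∀ {𝒰 𝒱 S} → 𝒰 ⊆ _ → 𝒱 ⊆ _ → Monotone S → 𝒰 ⊑ 𝒱 →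
                 Satisfiable 𝒰 × S 𝒰 → Satisfiable 𝒱 × S 𝒱
      transfer 𝒰⊆ 𝒱⊆ m 𝒰⊑𝒱 (s , holds) =
        t , m (subset-HAsg h 𝒰⊆ s) (subset-HAsg h′ 𝒱⊆ t) 𝒰⊑𝒱 holds
        where t = ⊑-satisfiable 𝒰⊑𝒱 s

    disj-antitone : Antitone S₁ → Antitone S₂ → Antitone (disj S₁ S₂)
    disj-antitone a₁ a₂ h h′ 𝒳⊑𝒳′ (𝒴₁ , 𝒴₂ , π@(_ , 𝒴⊆ , _) , s₁ , s₂)
      with par-⊑ 𝒳⊑𝒳′ π
    ... | 𝒳₁ , 𝒳₂ , π₀@(_ , 𝒳⊆ , _) , ⊑₁ , ⊑₂ =
      𝒳₁ , 𝒳₂ , π₀ , transfer (𝒳⊆ ∘ inj₁) (𝒴⊆ ∘ inj₁) a₁ ⊑₁ s₁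
                   , transfer (𝒳⊆ ∘ inj₂) (𝒴⊆ ∘ inj₂) a₂ ⊑₂ s₂
      where
      transfer : ∀ {𝒰 𝒱 S} → 𝒰 ⊆ _ → 𝒱 ⊆ _ → Antitone S → 𝒰 ⊑ 𝒱 →
                 (Satisfiable 𝒱 → S 𝒱) → Satisfiable 𝒰 → S 𝒰
      transfer 𝒰⊆ 𝒱⊆ a 𝒰⊑𝒱 holds s =
        a (subset-HAsg h 𝒰⊆ s) (subset-HAsg h′ 𝒱⊆ t) 𝒰⊑𝒱 (holds t)
        where t = ⊑-satisfiable 𝒰⊑𝒱 s

  module _ {S : Pred SetOfSets (lsuc 0ℓ)} where

    monotone∘dual : Monotone S → Antitone (S ∘ dual)
    monotone∘dual m h h′ 𝒳⊑𝒳′ =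
      m (dual-HAsg h′) (dual-HAsg h) (dual-antitone 𝒳⊑𝒳′)

    antitone∘dual : Antitone S → Monotone (S ∘ dual)
    antitone∘dual a h h′ 𝒳⊑𝒳′ =
      a (dual-HAsg h′) (dual-HAsg h) (dual-antitone 𝒳⊑𝒳′)

    monotone∘extσ : ∀ σ p → Monotone S → Monotone (λ 𝒳 → S (extσ σ 𝒳 p))
    monotone∘extσ σ p m h h′ 𝒳⊑𝒳′ =
      m (extσ-HAsg σ p h) (extσ-HAsg σ p h′) (extσ-monotone σ p h h′ 𝒳⊑𝒳′)

    antitone∘extσ : ∀ σ p → Antitone S → Antitone (λ 𝒳 → S (extσ σ 𝒳 p))
    antitone∘extσ σ p a h h′ 𝒳⊑𝒳′ =
      a (extσ-HAsg σ p h) (extσ-HAsg σ p h′) (extσ-monotone σ p h h′ 𝒳⊑𝒳′)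

  -- The two flags need a simultaneous induction: negation switches the flag, and so do the clauses
  -- evaluated at the dual, where the order is reversed.
  ⊨∃∀-monotone : ∀ φ → Monotone (_⊨[ ∃∀ ] φ)
  ⊨∀∃-antitone : ∀ φ → Antitone (_⊨[ ∀∃ ] φ)

  ⊨∃∀-monotone (ltl ψ) h h′ 𝒳⊑𝒳′ (lift (X , X∈𝒳 , all)) =
    let X′ , X′∈𝒳′ , X′⊆X = 𝒳⊑𝒳′ X∈𝒳
    in lift (X′ , X′∈𝒳′ , λ χ → all χ ∘ X′⊆X)
  ⊨∃∀-monotone (¬̇ φ) h h′ 𝒳⊑𝒳′ = contraposition (⊨∀∃-antitone φ h h′ 𝒳⊑𝒳′)
  ⊨∃∀-monotone (φ₁ ∧̇ φ₂) = conj-monotone (⊨∃∀-monotone φ₁) (⊨∃∀-monotone φ₂)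
  ⊨∃∀-monotone (φ₁ ∨̇ φ₂) =
    antitone∘dual (disj-antitone (⊨∀∃-antitone φ₁) (⊨∀∃-antitone φ₂))
  ⊨∃∀-monotone (∃̇ p ∶ σ ∙ φ) = monotone∘extσ σ p (⊨∃∀-monotone φ)
  ⊨∃∀-monotone (∀̇ p ∶ σ ∙ φ) = antitone∘dual (antitone∘extσ σ p (⊨∀∃-antitone φ))

  ⊨∀∃-antitone (ltl ψ) h h′ 𝒳⊑𝒳′ (lift some) = lift λ X X∈𝒳 →
    let X′ , X′∈𝒳′ , X′⊆X = 𝒳⊑𝒳′ X∈𝒳
        χ , χ∈X′ , χ⊨ψ    = some X′ X′∈𝒳′
    in χ , X′⊆X χ∈X′ , χ⊨ψ
  ⊨∀∃-antitone (¬̇ φ) h h′ 𝒳⊑𝒳′ = contraposition (⊨∃∀-monotone φ h h′ 𝒳⊑𝒳′)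
  ⊨∀∃-antitone (φ₁ ∧̇ φ₂) =
    monotone∘dual (conj-monotone (⊨∃∀-monotone φ₁) (⊨∃∀-monotone φ₂))
  ⊨∀∃-antitone (φ₁ ∨̇ φ₂) = disj-antitone (⊨∀∃-antitone φ₁) (⊨∀∃-antitone φ₂)
  ⊨∀∃-antitone (∃̇ p ∶ σ ∙ φ) = monotone∘dual (monotone∘extσ σ p (⊨∃∀-monotone φ))
  ⊨∀∃-antitone (∀̇ p ∶ σ ∙ φ) = antitone∘extσ σ p (⊨∀∃-antitone φ)

  -- Double dualisation and exchange of flags

  ⊨-dual² : ∀ α φ → HAsg P 𝒳 → (dual (dual 𝒳) ⊨[ α ] φ) ⇔ (𝒳 ⊨[ α ] φ)
  ⊨-dual² ∃∀ φ h = mk⇔ (⊨∃∀-monotone φ h² h dual²-⊑) (⊨∃∀-monotone φ h h² ⊑-dual²)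
    where h² = dual-HAsg (dual-HAsg h)
  ⊨-dual² ∀∃ φ h = mk⇔ (⊨∀∃-antitone φ h h² ⊑-dual²) (⊨∀∃-antitone φ h² h dual²-⊑)
    where h² = dual-HAsg (dual-HAsg h)

  ⊨-dual : ∀ α φ → HAsg P 𝒳 → (dual 𝒳 ⊨[ dualFlag α ] φ) ⇔ (𝒳 ⊨[ α ] φ)
  ⊨-dual ∃∀ (ltl ψ) h = mk⇔
    (λ (lift some) → lift
      (let X , X∈𝒳 , X⊆ = all-hit⇒∃⊆ (_⊨LTL ψ) (some _)
       in X , X∈𝒳 , λ _ → X⊆))
    (λ (lift (X , X∈𝒳 , all)) → lift λ Y (c , ch , _ , Y⊇) →
      c X , Y⊇ (X , X∈𝒳 , refl) , all _ (ch X X∈𝒳))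
  ⊨-dual {𝒳 = 𝒳} ∀∃ (ltl ψ) h = mk⇔
    (λ (lift (Y , (c , ch , _ , Y⊇) , all)) → lift λ X X∈𝒳 →
      c X , ch X X∈𝒳 , all _ (Y⊇ (X , X∈𝒳 , refl)))
    -- Skolemisation: one model of `ψ` is chosen from each `X`, and the image of this choice is a
    -- member of the dual made of models only.
    (λ (lift some) → lift
      (let R : 𝒫 Asg → Pred Asg 0ℓ
           R X = ⟦ X ⟧ ∩ (_⊨LTL ψ)
           c-∈ : ∀ X → X ∈ 𝒳 → select R X ∈ R X
           c-∈ X X∈𝒳 = select-∈ R (some X X∈𝒳)
       in image 𝒳 (select R) , image-∈ (λ X X∈𝒳 → proj₁ (c-∈ X X∈𝒳)) ,
          λ χ χ∈ → let X , X∈𝒳 , eq = proj₁ (⌜⌝-≐ (img 𝒳 (select R))) χ∈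
                   in subst (_⊨LTL ψ) eq (proj₂ (c-∈ X X∈𝒳))))
  ⊨-dual ∃∀ (¬̇ φ)         h = ¬-cong-⇔ (⊨-dual ∀∃ φ h)
  ⊨-dual ∀∃ (¬̇ φ)         h = ¬-cong-⇔ (⊨-dual ∃∀ φ h)
  -- If the clause for the flag on the left passes to the dual, the left side unfolds to
  -- satisfaction at `dual (dual 𝒳)`; if the clause on the right does, both sides are the same type.
  ⊨-dual ∃∀ φ@(_ ∧̇ _)     h = ⊨-dual² ∃∀ φ h
  ⊨-dual ∀∃ (_ ∧̇ _)       h = ⇔-id _
  ⊨-dual ∃∀ (_ ∨̇ _)       h = ⇔-id _
  ⊨-dual ∀∃ φ@(_ ∨̇ _)     h = ⊨-dual² ∀∃ φ h
  ⊨-dual ∃∀ φ@(∃̇ _ ∶ _ ∙ _) h = ⊨-dual² ∃∀ φ h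
  ⊨-dual ∀∃ (∃̇ _ ∶ _ ∙ _) h = ⇔-id _
  ⊨-dual ∃∀ (∀̇ _ ∶ _ ∙ _) h = ⇔-id _
  ⊨-dual ∀∃ φ@(∀̇ _ ∶ _ ∙ _) h = ⊨-dual² ∀∃ φ h

mainTheorem9 : (em : ExcludedMiddle 0ℓ) → Extensionality 0ℓ 0ℓ →
    (AP : Set) → let open GFG-QPTL AP (λ _ _ → em) in
    (φ : Formula) (𝒳 : SetOfSets) (α : Flag) → HAsg⊇ (free φ) 𝒳 →
    ((dual 𝒳 ⊨[ dualFlag α ] φ) ⇔ (dual (dual 𝒳) ⊨[ α ] φ)) ×
    ((dual (dual 𝒳) ⊨[ α ] φ) ⇔ (𝒳 ⊨[ α ] φ))
mainTheorem9 em ext AP φ 𝒳 α (_ , h , _) =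
  (⇔-sym (⊨-dual² α φ h) ⇔-∘ ⊨-dual α φ h) , ⊨-dual² α φ h
  where open DualInvariance em ext AP
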